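{- A left-linear TRS $\mathcal R$ is confluent if there exists a critical-pair-closing system $\mathcal C$ for $\mathcal R$ such that $\mathcal C$ is linear and strongly closed.
   Context: A TRS is a set of rules $\ell\to r$ between first-order terms, with $\ell$ not a variable and every variable of $r$ occurring in $\ell$; it is left-linear (linear) if no variable occurs more than once in any left-hand side (in any left-hand side and in any right-hand side). $\twoheadrightarrow_{\mathcal R}$, $\to^=_{\mathcal R}$ and $\leftrightarrow^*_{\mathcal R}$ are the reflexive-transitive closure, the reflexive closure and the convertibility relation of $\to_{\mathcal R}$. Critical pairs are the usual ones: for rules $\ell\to r$, $g\to d$ renamed apart, a non-variable position $p$ of $\ell$ and a most general unifier $\sigma$ of $\ell|_p$ and $g$, the pair $(r\sigma,(\ell[d]_p)\sigma)$ and its mirror image (overlaps of a rule with itself at the root are not excluded). A TRS $\mathcal C$ is a critical-pair-closing system for $\mathcal R$ if $\mathcal C\subseteq\mathcal R$ and $s\leftrightarrow^*_{\mathcal C}t$ for all critical pairs $(s,t)$ of $\mathcal R$. A TRS $\mathcal S$ is strongly closed if for all critical pairs $(s,t)$ of $\mathcal S$ both $s\twoheadrightarrow_{\mathcal S}\cdot\,{}^{=}_{\mathcal S}{\leftarrow}\ t$ and $s\to^=_{\mathcal S}\cdot\,{}_{\mathcal S}{\twoheadleftarrow}\ t$ hold. -}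

module Defs where

open import Data.Fin.Base using (Fin)
open import Data.List.Base using (List; []; _∷_; _++_)
open import Data.List.Relation.Binary.Disjoint.Propositional using (Disjoint)
open import Data.List.Relation.Binary.Subset.Propositional using (_⊆_)
open import Data.List.Relation.Unary.Unique.Propositional using (Unique)
open import Data.Nat.Base using (ℕ)
open import Data.Product.Base using (_×_; ∃)
open import Data.Vec.Base using (Vec; []; _∷_; lookup; _[_]≔_)
open import Function.Base using (_∘_)
open import Function.Definitions using (Injective)
open import Level using (Level; _⊔_; suc)
open import Relation.Binary.Construct.Closure.Equivalence using (EqClosure)
open import Relation.Binary.Construct.Closure.Reflexive using (ReflClosure)
open import Relation.Binary.Construct.Closure.ReflexiveTransitive using (Star)
open import Relation.Binary.Construct.Closure.Symmetric using (SymClosure)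
open import Relation.Binary.Core using (Rel; _⇒_)
open import Relation.Binary.PropositionalEquality.Core using (_≡_)
open import Relation.Nullary.Negation.Core using (¬_)

record Signature (o : Level) : Set (suc o) where
  field
    Symbol : Set o
    arity  : Symbol → ℕ

data Term {o : Level} (F : Signature o) : Set o where
  var : ℕ → Term F
  fun : (f : Signature.Symbol F) → Vec (Term F) (Signature.arity F f) → Term F

module _ {o : Level} {F : Signature o} where

  open Signature F using (arity)

  data IsVar : Term F → Set o where
    isVar : ∀ x → IsVar (var x)

  -- All variable occurrences from left to right, with multiplicity.
  mutual
    vars : Term F → List ℕ
    vars (var x)    = x ∷ []
    vars (fun f ts) = varsᵥ ts

    varsᵥ : ∀ {n} → Vec (Term F) n → List ℕ
    varsᵥ []       = []
    varsᵥ (t ∷ ts) = vars t ++ varsᵥ ts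

  LinearTerm : Term F → Set
  LinearTerm t = Unique (vars t)

  infixl 8 _·_ _·ᵥ_

  mutual
    _·_ : Term F → (ℕ → Term F) → Term F
    var x    · σ = σ x
    fun f ts · σ = fun f (ts ·ᵥ σ)

    _·ᵥ_ : ∀ {n} → Vec (Term F) n → (ℕ → Term F) → Vec (Term F) n
    []       ·ᵥ σ = []
    (t ∷ ts) ·ᵥ σ = t · σ ∷ ts ·ᵥ σ

  rename : (ℕ → ℕ) → Term F → Term F
  rename ρ t = t · (var ∘ ρ)

  data Pos : Term F → Set o where
    here  : ∀ {t} → Pos t
    there : ∀ {f ts} (i : Fin (arity f)) → Pos (lookup ts i) → Pos (fun f ts)

  infix 9 _∣_ _[_]at_

  _∣_ : (t : Term F) → Pos t → Term F
  t        ∣ here      = t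
  fun f ts ∣ there i p = lookup ts i ∣ p

  _[_]at_ : (t : Term F) → Term F → Pos t → Term F
  t        [ u ]at here      = u
  fun f ts [ u ]at there i p = fun f (ts [ i ]≔ (lookup ts i [ u ]at p))

  IsUnifier : (ℕ → Term F) → Term F → Term F → Set o
  IsUnifier σ s t = s · σ ≡ t · σ

  record IsMGU (σ : ℕ → Term F) (s t : Term F) : Set o where
    field
      unifies     : IsUnifier σ s t
      mostGeneral : ∀ τ → IsUnifier τ s t → ∃ λ δ → ∀ x → τ x ≡ σ x · δ

-- Rule l r expresses that l → r is a rule of the system.
record TRS {o : Level} (F : Signature o) (ℓ : Level) : Set (o ⊔ suc ℓ) where
  field
    Rule      : Rel (Term F) ℓ
    lhs-¬var  : ∀ {l r} → Rule l r → ¬ IsVar l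
    rhs⊆lhs   : ∀ {l r} → Rule l r → vars r ⊆ vars l

open TRS using (Rule)

module _ {o ℓ : Level} {F : Signature o} (R : TRS F ℓ) where

  LeftLinear : Set (o ⊔ ℓ)
  LeftLinear = ∀ {l r} → Rule R l r → LinearTerm l

  Linear : Set (o ⊔ ℓ)
  Linear = ∀ {l r} → Rule R l r → LinearTerm l × LinearTerm r

  data Step : Rel (Term F) (o ⊔ ℓ) where
    step : ∀ {s l r} (p : Pos s) (σ : ℕ → Term F) →
           Rule R l r → s ∣ p ≡ l · σ → Step s (s [ r · σ ]at p)

  data Variant : Rel (Term F) (o ⊔ ℓ) where
    variant : ∀ {l r} (ρ : ℕ → ℕ) → Injective _≡_ _≡_ ρ →
              Rule R l r → Variant (rename ρ l) (rename ρ r)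

  -- Right-hand sides introduce no variables, so it suffices that the
  -- left-hand sides are renamed apart.
  data CriticalOverlap : Rel (Term F) (o ⊔ ℓ) where
    critical : ∀ {l r g d} → Variant l r → Variant g d →
               Disjoint (vars l) (vars g) →
               (p : Pos l) → ¬ IsVar (l ∣ p) →
               (σ : ℕ → Term F) → IsMGU σ (l ∣ p) g →
               CriticalOverlap (r · σ) ((l [ d ]at p) · σ)

  CriticalPair : Rel (Term F) (o ⊔ ℓ)
  CriticalPair = SymClosure CriticalOverlap

  StronglyClosed : Set (o ⊔ ℓ)
  StronglyClosed = ∀ {s t} → CriticalPair s t →
    (∃ λ u → Star Step s u × ReflClosure Step t u) ×
    (∃ λ u → ReflClosure Step s u × Star Step t u)

record CriticalPairClosing {o ℓ₁ ℓ₂ : Level} {F : Signature o}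
                           (C : TRS F ℓ₁) (R : TRS F ℓ₂) : Set (o ⊔ ℓ₁ ⊔ ℓ₂) where
  field
    subsystem : Rule C ⇒ Rule R
    closes    : CriticalPair R ⇒ EqClosure (Step C)

{-# OPTIONS --safe #-}

-- Label a parallel step by the number of redexes it contracts. A peak of parallel steps
-- t ⇇ s ⇉ u with labels n and m either is orthogonal and closed by one parallel step on each
-- side, or contains an overlap; contracting only the two overlapping redexes first gives
-- t ⇇ t′ ≈ u′ ⇉ u with strictly smaller labels, where ≈ is generated by the critical pairs.
-- With ≈ strong joinability in C this is Huet's lemma, so C is confluent. With ≈ convertibility
-- in C, parallel R-steps are projected over C-steps without raising the label, because C is
-- linear; an induction on n + m then shows that parallel steps modulo ≈ have the diamond
-- property. Confluence of C finally turns the closing steps modulo ≈ into R-reductions.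

module Submission where

open import Defs
open import Data.Bool.Base using (true; false; if_then_else_)
open import Data.Fin.Base using (Fin; zero; suc)
open import Data.List.Base using (List; []; _∷_; _++_; map)
open import Data.List.Membership.DecPropositional using (_∈?_)
open import Data.List.Membership.Propositional using (_∈_; _∉_)
open import Data.List.Membership.Propositional.Properties
  using (∈-++⁺ˡ; ∈-++⁺ʳ; ∈-++⁻; ∈-∃++; ∈-map⁻)
open import Data.List.Properties using (map-++; map-cong-local)
open import Data.List.Relation.Binary.Disjoint.Propositional using (Disjoint)
open import Data.List.Relation.Binary.Subset.Propositional using (_⊆_)
import Data.List.Relation.Unary.All as All
import Data.List.Relation.Unary.All.Properties as All
open import Data.List.Relation.Unary.AllPairs using ([]; _∷_)
open import Data.List.Relation.Unary.Any using (here; there)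
open import Data.List.Relation.Unary.Unique.Propositional using (Unique)
open import Data.List.Relation.Unary.Unique.Propositional.Properties
  using (map⁺)
open import Data.Nat.Base using (ℕ; zero; suc; _+_; _≤_; _<_; z≤n; s≤s)
open import Data.Nat.ListAction using (sum)
open import Data.Nat.ListAction.Properties using (sum-++)
open import Data.Nat.Properties as ℕ using (_≟_)
open import Data.Product.Base using (_×_; ∃; ∃₂; _,_; proj₁; proj₂)
open import Data.Sum.Base using (inj₁; inj₂)
open import Data.Vec.Base using (Vec; []; _∷_; lookup; _[_]≔_)
open import Data.Vec.Properties using (∷-injective; []≔-idempotent; lookup∘update)
open import Function.Base using (_∘_; id; const; case_of_)
open import Level using (Level; _⊔_)
open import Relation.Binary.Construct.Closure.Equivalence as Eq using (EqClosure)
open import Relation.Binary.Construct.Closure.Reflexive as Refl using (ReflClosure; refl; [_])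
open import Relation.Binary.Construct.Closure.ReflexiveTransitive as Star using (Star; ε; _◅_; _◅◅_)
open import Relation.Binary.Construct.Closure.Symmetric using (fwd; bwd)
open import Relation.Binary.Core using (Rel; _⇒_)
open import Relation.Binary.Definitions using (Symmetric)
open import Relation.Binary.PropositionalEquality
  using (_≡_; refl; sym; trans; cong; cong₂; subst; subst₂)
open import Relation.Binary.Rewriting using (Confluent)
open import Relation.Nullary.Decidable.Core using (does; yes; no)
open import Relation.Nullary.Negation.Core using (¬_; contradiction)

open TRS using (Rule; rhs⊆lhs)

-- Abstract rewriting

module _ {a ℓ} {A : Set a} {_⟶_ : Rel A ℓ} where

  StronglyConfluent : Set _
  StronglyConfluent = ∀ {s t u} → s ⟶ t → s ⟶ u →
                      ∃ λ v → Star _⟶_ t v × ReflClosure _⟶_ u v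

  stronglyConfluent⇒confluent : StronglyConfluent → Confluent _⟶_
  stronglyConfluent⇒confluent sc = conf
    where
    -- The right-hand reduction is crossed one step at a time. The induction goes through because
    -- what remains of the single step is again at most one step.
    strip : ∀ {s t u} → ReflClosure _⟶_ s t → Star _⟶_ s u →
            ∃ λ v → Star _⟶_ t v × ReflClosure _⟶_ u v
    strip refl  q       = _ , q , refl
    strip [ p ] ε       = _ , ε , [ p ]
    strip [ p ] (x ◅ q) =
      let _ , t↠ , ux = sc p x
          _ , v↠ , w  = strip ux q
      in _ , t↠ ◅◅ v↠ , w

    refl⇒star : ReflClosure _⟶_ ⇒ Star _⟶_
    refl⇒star refl  = ε
    refl⇒star [ p ] = p ◅ ε

    conf : Confluent _⟶_
    conf ε       q = _ , q , ε
    conf (x ◅ p) q =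
      let _ , x↠ , uv = strip [ x ] q
          _ , b , c   = conf p x↠
      in _ , b , refl⇒star uv ◅◅ c

  confluent⇒churchRosser : Confluent _⟶_ → ∀ {s t} → EqClosure _⟶_ s t →
                           ∃ λ u → Star _⟶_ s u × Star _⟶_ t u
  confluent⇒churchRosser conf ε           = _ , ε , ε
  confluent⇒churchRosser conf (fwd x ◅ p) =
    let _ , b , c = confluent⇒churchRosser conf p
    in _ , x ◅ b , c
  confluent⇒churchRosser conf (bwd x ◅ p) =
    let _ , b , c = confluent⇒churchRosser conf p
        _ , d , e = conf (x ◅ ε) b
    in _ , d , c ◅◅ e

  star⇒eq : Star _⟶_ ⇒ EqClosure _⟶_
  star⇒eq = Star.map fwd

-- Lists of variables

Unique-++⁻ : ∀ {a} {A : Set a} (xs : List A) {ys} → Unique (xs ++ ys) →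
             Unique xs × Unique ys × Disjoint xs ys
Unique-++⁻ []       u       = [] , u , λ { (() , _) }
Unique-++⁻ (x ∷ xs) (x∉ ∷ u) =
  let ux , uy , dis = Unique-++⁻ xs u
  in All.++⁻ˡ xs x∉ ∷ ux , uy ,
     λ { (here refl , v∈ys) → All.lookup (All.++⁻ʳ xs x∉) v∈ys refl
       ; (there v∈xs , v∈ys) → dis (v∈xs , v∈ys) }

∈-remove : ∀ {a} {A : Set a} {x y : A} (as : List A) {bs} →
           y ∈ as ++ x ∷ bs → ¬ (x ≡ y) → y ∈ as ++ bs
∈-remove as y∈ x≢y with ∈-++⁻ as y∈
... | inj₁ y∈as         = ∈-++⁺ˡ y∈as
... | inj₂ (here refl)  = contradiction refl x≢y
... | inj₂ (there y∈bs) = ∈-++⁺ʳ as y∈bs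

sum-map-++ : ∀ (k : ℕ → ℕ) xs ys →
             sum (map k (xs ++ ys)) ≡ sum (map k xs) + sum (map k ys)
sum-map-++ k xs ys = trans (cong sum (map-++ k xs ys)) (sum-++ (map k xs) (map k ys))

-- One occurrence of the head of `xs` is deleted from `ys`; by uniqueness the tail is still
-- contained in what remains. With the variables of a linear right-hand side as `xs`, this bounds
-- the number of residual redexes.
sum-map-⊆ : ∀ (k : ℕ → ℕ) {xs ys} → Unique xs → xs ⊆ ys →
            sum (map k xs) ≤ sum (map k ys)
sum-map-⊆ k {[]}     _             _     = z≤n
sum-map-⊆ k {x ∷ xs} (x≢xs ∷ xs!) xs⊆ys with ∈-∃++ (xs⊆ys (here refl))
... | as , bs , refl = begin
  k x + sum (map k xs)                          ≤⟨ ℕ.+-monoʳ-≤ (k x) (sum-map-⊆ k xs! rest) ⟩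
  k x + sum (map k (as ++ bs))                  ≡⟨ cong (k x +_) (sum-map-++ k as bs) ⟩
  k x + (sum (map k as) + sum (map k bs))       ≡⟨ ℕ.+-assoc (k x) _ _ ⟨
  k x + sum (map k as) + sum (map k bs)         ≡⟨ cong (_+ sum (map k bs)) (ℕ.+-comm (k x) _) ⟩
  sum (map k as) + k x + sum (map k bs)         ≡⟨ ℕ.+-assoc (sum (map k as)) _ _ ⟩
  sum (map k as) + (k x + sum (map k bs))       ≡⟨ sum-map-++ k as (x ∷ bs) ⟨
  sum (map k (as ++ x ∷ bs))                    ∎
  where
  open ℕ.≤-Reasoning
  rest : xs ⊆ as ++ bs
  rest y∈ = ∈-remove as (xs⊆ys (there y∈)) (All.lookup x≢xs y∈)

sum-map-cong : ∀ {k k′ : ℕ → ℕ} xs → (∀ {x} → x ∈ xs → k x ≡ k′ x) →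
               sum (map k xs) ≡ sum (map k′ xs)
sum-map-cong xs eq = cong sum (map-cong-local (All.tabulate eq))

-- Combining functions on variables

module _ {a} {A : Set a} where

  merge : List ℕ → (f g : ℕ → A) → ℕ → A
  merge xs f g x = if does (_∈?_ _≟_ x xs) then f x else g x

  merge-∈ : ∀ xs f g {x} → x ∈ xs → merge xs f g x ≡ f x
  merge-∈ xs f g {x} x∈xs with _∈?_ _≟_ x xs
  ... | yes _   = refl
  ... | no x∉xs = contradiction x∈xs x∉xs

  merge-∉ : ∀ xs f g {x} → x ∉ xs → merge xs f g x ≡ g x
  merge-∉ xs f g {x} x∉xs with _∈?_ _≟_ x xs
  ... | yes x∈xs = contradiction x∈xs x∉xs
  ... | no _     = refl

  -- The two rules of an overlap are renamed apart by sending variables to even and to odd numbers;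
  -- this puts their substitutions together into one.
  interleave : (f g : ℕ → A) → ℕ → A
  interleave f g zero          = f 0
  interleave f g (suc zero)    = g 0
  interleave f g (suc (suc n)) = interleave (f ∘ suc) (g ∘ suc) n

double : ℕ → ℕ
double zero    = zero
double (suc n) = suc (suc (double n))

module _ {a} {A : Set a} where

  interleave-even : ∀ (f g : ℕ → A) n → interleave f g (double n) ≡ f n
  interleave-even f g zero    = refl
  interleave-even f g (suc n) = interleave-even (f ∘ suc) (g ∘ suc) n

  interleave-odd : ∀ (f g : ℕ → A) n → interleave f g (suc (double n)) ≡ g n
  interleave-odd f g zero    = refl
  interleave-odd f g (suc n) = interleave-odd (f ∘ suc) (g ∘ suc) n

double-injective : ∀ {m n} → double m ≡ double n → m ≡ n
double-injective {m} {n} eq =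
  -- `interleave id id` halves a number and so undoes `double`.
  trans (sym (interleave-even id id m)) (trans (cong (interleave id id) eq) (interleave-even id id n))

even≢odd : ∀ m n → ¬ (double m ≡ suc (double n))
-- Interleaving the two constant functions gives the parity, which differs on the two sides of `eq`.
even≢odd m n eq = case trans (sym (interleave-even (const true) (const false) m))
                       (trans (cong (interleave (const true) (const false)) eq)
                              (interleave-odd (const true) (const false) n)) of λ ()

-- Substitutions and subterms

module _ {o : Level} {F : Signature o} where

  open Signature F using (arity)

  Subst : Set o
  Subst = ℕ → Term F

  mutual
    ·-cong : ∀ t {σ τ : Subst} → (∀ {x} → x ∈ vars t → σ x ≡ τ x) → t · σ ≡ t · τ
    ·-cong (var x)    eq = eq (here refl)
    ·-cong (fun f ts) eq = cong (fun f) (·ᵥ-cong ts eq)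

    ·ᵥ-cong : ∀ {n} (ts : Vec (Term F) n) {σ τ : Subst} →
              (∀ {x} → x ∈ varsᵥ ts → σ x ≡ τ x) → ts ·ᵥ σ ≡ ts ·ᵥ τ
    ·ᵥ-cong []       eq = refl
    ·ᵥ-cong (t ∷ ts) eq = cong₂ _∷_ (·-cong t (eq ∘ ∈-++⁺ˡ)) (·ᵥ-cong ts (eq ∘ ∈-++⁺ʳ (vars t)))

  mutual
    ·-var : ∀ (t : Term F) → t · var ≡ t
    ·-var (var x)    = refl
    ·-var (fun f ts) = cong (fun f) (·ᵥ-var ts)

    ·ᵥ-var : ∀ {n} (ts : Vec (Term F) n) → ts ·ᵥ var ≡ ts
    ·ᵥ-var []       = refl
    ·ᵥ-var (t ∷ ts) = cong₂ _∷_ (·-var t) (·ᵥ-var ts)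

  mutual
    ·-· : ∀ t {σ τ υ : Subst} → (∀ x → σ x · τ ≡ υ x) → t · σ · τ ≡ t · υ
    ·-· (var x)    eq = eq x
    ·-· (fun f ts) eq = cong (fun f) (·ᵥ-·ᵥ ts eq)

    ·ᵥ-·ᵥ : ∀ {n} (ts : Vec (Term F) n) {σ τ υ : Subst} →
            (∀ x → σ x · τ ≡ υ x) → ts ·ᵥ σ ·ᵥ τ ≡ ts ·ᵥ υ
    ·ᵥ-·ᵥ []       eq = refl
    ·ᵥ-·ᵥ (t ∷ ts) eq = cong₂ _∷_ (·-· t eq) (·ᵥ-·ᵥ ts eq)

  mutual
    vars-rename : ∀ ρ (t : Term F) → vars (rename ρ t) ≡ map ρ (vars t)
    vars-rename ρ (var x)    = refl
    vars-rename ρ (fun f ts) = varsᵥ-rename ρ ts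

    varsᵥ-rename : ∀ ρ {n} (ts : Vec (Term F) n) →
                   varsᵥ (ts ·ᵥ (var ∘ ρ)) ≡ map ρ (varsᵥ ts)
    varsᵥ-rename ρ []       = refl
    varsᵥ-rename ρ (t ∷ ts) =
      trans (cong₂ _++_ (vars-rename ρ t) (varsᵥ-rename ρ ts)) (sym (map-++ ρ (vars t) (varsᵥ ts)))

  lookup-·ᵥ : ∀ {n} (ts : Vec (Term F) n) σ i → lookup (ts ·ᵥ σ) i ≡ lookup ts i · σ
  lookup-·ᵥ (t ∷ ts) σ zero    = refl
  lookup-·ᵥ (t ∷ ts) σ (suc i) = lookup-·ᵥ ts σ i

  []≔-·ᵥ : ∀ {n} (ts : Vec (Term F) n) σ i u → (ts [ i ]≔ u) ·ᵥ σ ≡ (ts ·ᵥ σ) [ i ]≔ u · σ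
  []≔-·ᵥ (t ∷ ts) σ zero    u = refl
  []≔-·ᵥ (t ∷ ts) σ (suc i) u = cong (t · σ ∷_) ([]≔-·ᵥ ts σ i u)

  infix 4 _⊴_ _⊴ᵥ_

  mutual
    -- An occurrence carries its subterm as an index, so that it passes to instances by `⊴-·`
    -- without transport along lookups. `position` translates it to `Pos`, in which critical pairs
    -- are stated.
    data _⊴_ (s : Term F) : Term F → Set o where
      here   : s ⊴ s
      inside : ∀ {f ts} → s ⊴ᵥ ts → s ⊴ fun f ts

    data _⊴ᵥ_ (s : Term F) : ∀ {n} → Vec (Term F) n → Set o where
      head : ∀ {n t} {ts : Vec (Term F) n} → s ⊴ t → s ⊴ᵥ t ∷ ts
      tail : ∀ {n t} {ts : Vec (Term F) n} → s ⊴ᵥ ts → s ⊴ᵥ t ∷ ts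

  mutual
    replace : ∀ {s t} → s ⊴ t → Term F → Term F
    replace here               u = u
    replace (inside {f = f} p) u = fun f (replaceᵥ p u)

    replaceᵥ : ∀ {s n} {ts : Vec (Term F) n} → s ⊴ᵥ ts → Term F → Vec (Term F) n
    replaceᵥ (head {ts = ts} p) u = replace p u ∷ ts
    replaceᵥ (tail {t = t} p)   u = t ∷ replaceᵥ p u

  mutual
    ⊴-· : ∀ {s t} σ → s ⊴ t → s · σ ⊴ t · σ
    ⊴-· σ here       = here
    ⊴-· σ (inside p) = inside (⊴ᵥ-·ᵥ σ p)

    ⊴ᵥ-·ᵥ : ∀ {s n} {ts : Vec (Term F) n} σ → s ⊴ᵥ ts → s · σ ⊴ᵥ ts ·ᵥ σ
    ⊴ᵥ-·ᵥ σ (head p) = head (⊴-· σ p)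
    ⊴ᵥ-·ᵥ σ (tail p) = tail (⊴ᵥ-·ᵥ σ p)

  module _ {σ τ υ : Subst} (eq : ∀ x → σ x · τ ≡ υ x) (u : Term F) where
    mutual
      -- Used with a renaming as `σ` and the combined substitution as `τ`: it turns an instance of
      -- the renamed overlap back into the original one. The inserted `u` is renamed beforehand,
      -- hence only `τ` acts on it.
      replace-· : ∀ {s t} (p : s ⊴ t) → replace (⊴-· σ p) u · τ ≡ replace (⊴-· υ p) (u · τ)
      replace-· here               = refl
      replace-· (inside {f = f} p) = cong (fun f) (replaceᵥ-· p)

      replaceᵥ-· : ∀ {s n} {ts : Vec (Term F) n} (p : s ⊴ᵥ ts) →
                   replaceᵥ (⊴ᵥ-·ᵥ σ p) u ·ᵥ τ ≡ replaceᵥ (⊴ᵥ-·ᵥ υ p) (u · τ)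
      replaceᵥ-· (head {ts = ts} p) = cong₂ _∷_ (replace-· p) (·ᵥ-·ᵥ ts eq)
      replaceᵥ-· (tail {t = t} p)   = cong₂ _∷_ (·-· t eq) (replaceᵥ-· p)

  index : ∀ {s n} {ts : Vec (Term F) n} → s ⊴ᵥ ts → Fin n
  index (head p) = zero
  index (tail p) = suc (index p)

  mutual
    position : ∀ {s t} → s ⊴ t → Pos t
    position here       = here
    position (inside p) = there (index p) (positionᵥ p)

    positionᵥ : ∀ {s n} {ts : Vec (Term F) n} (p : s ⊴ᵥ ts) → Pos (lookup ts (index p))
    positionᵥ (head p) = position p
    positionᵥ (tail p) = positionᵥ p

  mutual
    ∣-position : ∀ {s t} (p : s ⊴ t) → t ∣ position p ≡ s
    ∣-position here       = refl
    ∣-position (inside p) = ∣-positionᵥ p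

    ∣-positionᵥ : ∀ {s n} {ts : Vec (Term F) n} (p : s ⊴ᵥ ts) →
                  lookup ts (index p) ∣ positionᵥ p ≡ s
    ∣-positionᵥ (head p) = ∣-position p
    ∣-positionᵥ (tail p) = ∣-positionᵥ p

  mutual
    []at-position : ∀ {s t} (p : s ⊴ t) u → t [ u ]at position p ≡ replace p u
    []at-position here               u = refl
    []at-position (inside {f = f} p) u = cong (fun f) ([]at-positionᵥ p u)

    []at-positionᵥ : ∀ {s n} {ts : Vec (Term F) n} (p : s ⊴ᵥ ts) u →
                     ts [ index p ]≔ (lookup ts (index p) [ u ]at positionᵥ p) ≡ replaceᵥ p u
    []at-positionᵥ (head {ts = ts} p) u = cong (_∷ ts) ([]at-position p u)
    []at-positionᵥ (tail {t = t} p)   u = cong (t ∷_) ([]at-positionᵥ p u)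

  mutual
    vars-⊴ : ∀ {s t} → s ⊴ t → vars s ⊆ vars t
    vars-⊴ here       = id
    vars-⊴ (inside p) = vars-⊴ᵥ p

    vars-⊴ᵥ : ∀ {s n} {ts : Vec (Term F) n} → s ⊴ᵥ ts → vars s ⊆ varsᵥ ts
    vars-⊴ᵥ (head p)         = ∈-++⁺ˡ ∘ vars-⊴ p
    vars-⊴ᵥ (tail {t = t} p) = ∈-++⁺ʳ (vars t) ∘ vars-⊴ᵥ p

  mutual
    linear-⊴ : ∀ {s t} → s ⊴ t → LinearTerm t → LinearTerm s
    linear-⊴ here       lin = lin
    linear-⊴ (inside p) lin = linear-⊴ᵥ p lin

    linear-⊴ᵥ : ∀ {s n} {ts : Vec (Term F) n} → s ⊴ᵥ ts → Unique (varsᵥ ts) → LinearTerm s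
    linear-⊴ᵥ (head {t = t} p) lin = linear-⊴ p (proj₁ (Unique-++⁻ (vars t) lin))
    linear-⊴ᵥ (tail {t = t} p) lin = linear-⊴ᵥ p (proj₁ (proj₂ (Unique-++⁻ (vars t) lin)))

  ¬var-· : ∀ {t} {σ : Subst} → ¬ IsVar t → ¬ IsVar (t · σ)
  ¬var-· {var x} ¬v _ = ¬v (isVar x)

  -- Unification of linear terms without common variables

  fun-injectiveˡ : ∀ {f g} {ss : Vec (Term F) (arity f)} {ts : Vec (Term F) (arity g)} →
                   fun f ss ≡ fun g ts → f ≡ g
  fun-injectiveˡ refl = refl

  fun-injectiveʳ : ∀ {f} {ss ts : Vec (Term F) (arity f)} → Term.fun {F = F} f ss ≡ fun f ts → ss ≡ ts
  fun-injectiveʳ refl = refl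

  _↦_ : ℕ → Term F → Subst
  (x ↦ t) = merge (x ∷ []) (const t) var

  ↦-≡ : ∀ x t → (x ↦ t) x ≡ t
  ↦-≡ x t = merge-∈ (x ∷ []) (const t) var (here refl)

  ↦-≢ : ∀ x t {y} → ¬ (y ≡ x) → (x ↦ t) y ≡ var y
  ↦-≢ x t y≢x = merge-∉ (x ∷ []) (const t) var λ { (here y≡x) → y≢x y≡x }

  ↦-· : ∀ {x t} → x ∉ vars t → t · (x ↦ t) ≡ t
  ↦-· {x} {t} x∉t =
    trans (·-cong t λ y∈t → ↦-≢ x t λ { refl → x∉t y∈t }) (·-var t)

  ↦-mostGeneral : ∀ {x t} {τ : Subst} → τ x ≡ t · τ → ∀ y → τ y ≡ (x ↦ t) y · τ
  ↦-mostGeneral {x} {t} {τ} eq y with y ≟ x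
  ... | yes refl = trans eq (cong (_· τ) (sym (↦-≡ x t)))
  ... | no y≢x   = cong (_· τ) (sym (↦-≢ x t y≢x))

  -- Neither an occurs check nor decidable equality of symbols is needed: different arguments
  -- share no variables, and the given unifier υ excludes clashes. As the unifier σ is
  -- idempotent, every unifier τ factors as σ followed by τ itself.
  mutual
    mgu : ∀ s t → LinearTerm s → LinearTerm t → Disjoint (vars s) (vars t) →
          ∀ υ → s · υ ≡ t · υ →
          ∃ λ σ → s · σ ≡ t · σ × (∀ τ → s · τ ≡ t · τ → ∀ x → τ x ≡ σ x · τ)
    mgu (var x) t _ _ dis _ _ =
      (x ↦ t) ,
      trans (↦-≡ x t) (sym (↦-· λ x∈t → dis (here refl , x∈t))) ,
      λ _ eq → ↦-mostGeneral eq
    mgu s@(fun _ _) (var x) _ _ dis _ _ =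
      (x ↦ s) ,
      trans (↦-· λ x∈s → dis (x∈s , here refl)) (sym (↦-≡ x s)) ,
      λ _ eq → ↦-mostGeneral (sym eq)
    mgu (fun f ss) (fun g ts) lins lint dis υ eq with fun-injectiveˡ eq
    ... | refl =
      let σ , uni , mg = mguᵥ ss ts lins lint dis υ (fun-injectiveʳ eq)
      in σ , cong (fun f) uni , λ τ → mg τ ∘ fun-injectiveʳ

    mguᵥ : ∀ {n} (ss ts : Vec (Term F) n) → Unique (varsᵥ ss) → Unique (varsᵥ ts) →
           Disjoint (varsᵥ ss) (varsᵥ ts) → ∀ υ → ss ·ᵥ υ ≡ ts ·ᵥ υ →
           ∃ λ σ → ss ·ᵥ σ ≡ ts ·ᵥ σ × (∀ τ → ss ·ᵥ τ ≡ ts ·ᵥ τ → ∀ x → τ x ≡ σ x · τ)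
    mguᵥ []       []       _    _    _   _ _  = var , refl , λ _ _ _ → refl
    mguᵥ (s ∷ ss) (t ∷ ts) lins lint dis υ eq
      with Unique-++⁻ (vars s) lins | Unique-++⁻ (vars t) lint | ∷-injective eq
    ... | lin-s , lin-ss , dis-s | lin-t , lin-ts , dis-t | eq₁ , eq₂
      with mgu s t lin-s lin-t (λ (a , b) → dis (∈-++⁺ˡ a , ∈-++⁺ˡ b)) υ eq₁
         | mguᵥ ss ts lin-ss lin-ts (λ (a , b) → dis (∈-++⁺ʳ (vars s) a , ∈-++⁺ʳ (vars t) b)) υ eq₂
    ... | σ₁ , uni₁ , mg₁ | σ₂ , uni₂ , mg₂ =
      σ ,
      cong₂ _∷_
        (trans (·-cong s (σ-∈ ∘ ∈-++⁺ˡ)) (trans uni₁ (sym (·-cong t (σ-∈ ∘ ∈-++⁺ʳ (vars s))))))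
        (trans (·ᵥ-cong ss (σ-∉ ∘ ∉-ss)) (trans uni₂ (sym (·ᵥ-cong ts (σ-∉ ∘ ∉-ts))))) ,
      mostGeneral
      where
      st = vars s ++ vars t

      σ : Subst
      σ = merge st σ₁ σ₂

      σ-∈ : ∀ {x} → x ∈ st → σ x ≡ σ₁ x
      σ-∈ = merge-∈ st σ₁ σ₂

      σ-∉ : ∀ {x} → x ∉ st → σ x ≡ σ₂ x
      σ-∉ = merge-∉ st σ₁ σ₂

      -- Linearity separates `ss` from `s` and disjointness separates it from `t`, so `σ₁` does not
      -- interfere with `σ₂`.
      ∉-ss : ∀ {x} → x ∈ varsᵥ ss → x ∉ st
      ∉-ss x∈ss x∈st with ∈-++⁻ (vars s) x∈st
      ... | inj₁ x∈s = dis-s (x∈s , x∈ss)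
      ... | inj₂ x∈t = dis (∈-++⁺ʳ (vars s) x∈ss , ∈-++⁺ˡ x∈t)

      ∉-ts : ∀ {x} → x ∈ varsᵥ ts → x ∉ st
      ∉-ts x∈ts x∈st with ∈-++⁻ (vars s) x∈st
      ... | inj₁ x∈s = dis (∈-++⁺ˡ x∈s , ∈-++⁺ʳ (vars t) x∈ts)
      ... | inj₂ x∈t = dis-t (x∈t , x∈ts)

      mostGeneral : ∀ τ → (s ∷ ss) ·ᵥ τ ≡ (t ∷ ts) ·ᵥ τ → ∀ x → τ x ≡ σ x · τ
      -- Both factorisations have `τ` itself as second factor and can therefore be pasted variable
      -- by variable.
      mostGeneral τ eq′ x with ∷-injective eq′ | _∈?_ _≟_ x st
      ... | e , _ | yes _ = mg₁ τ e x
      ... | _ , e | no _  = mg₂ τ e x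

  -- Overlaps as instances of critical pairs

  module _ {ℓ} (R : TRS F ℓ) (leftLinear : LeftLinear R) where

    -- After renaming to even and odd variables, `θ` unifies `l₀′` and `g′`. Since `μ` followed by
    -- `θ` is again `θ`, the substitution `θ` itself instantiates the critical pair to the given
    -- overlap.
    overlap-criticalPair : ∀ {l r g d l₀ σ τ} → Rule R l r → Rule R g d →
      (p : l₀ ⊴ l) → ¬ IsVar l₀ → l₀ · σ ≡ g · τ →
      ∃₂ λ s t → ∃ λ θ → CriticalOverlap R s t ×
        s · θ ≡ r · σ × t · θ ≡ replace (⊴-· σ p) (d · τ)
    overlap-criticalPair {l} {r} {g} {d} {l₀} {σ} {τ} lr gd p ¬v eq = _ , _ , θ ,
      critical (variant ρ₁ double-injective lr)
               (variant ρ₂ (double-injective ∘ ℕ.suc-injective) gd)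
               disjoint (position p′)
               (subst (¬_ ∘ IsVar) (sym (∣-position p′)) (¬var-· ¬v))
               μ (record
                   { unifies     = subst (λ s → s · μ ≡ g′ · μ) (sym (∣-position p′)) uni
                   ; mostGeneral = λ τ′ e → τ′ ,
                       mg τ′ (subst (λ s → s · τ′ ≡ g′ · τ′) (∣-position p′) e) }) ,
      trans (·-· (rename ρ₁ r) μθ) (·-· r θ-even) ,
      trans (cong (λ t → t · μ · θ) ([]at-position p′ d′))
        (trans (·-· (replace p′ d′) μθ)
          (trans (replace-· θ-even d′ p) (cong (replace (⊴-· σ p)) (·-· d θ-odd))))
      where
      ρ₁ ρ₂ : ℕ → ℕ
      ρ₁ = double
      ρ₂ = suc ∘ double

      l₀′ g′ d′ : Term F
      l₀′ = rename ρ₁ l₀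
      g′  = rename ρ₂ g
      d′  = rename ρ₂ d

      p′ : l₀′ ⊴ rename ρ₁ l
      p′ = ⊴-· (var ∘ ρ₁) p

      θ : Subst
      θ = interleave σ τ

      θ-even : ∀ x → θ (ρ₁ x) ≡ σ x
      θ-even = interleave-even σ τ

      θ-odd : ∀ x → θ (ρ₂ x) ≡ τ x
      θ-odd = interleave-odd σ τ

      linear-rename : ∀ {ρ t} → (∀ {x y} → ρ x ≡ ρ y → x ≡ y) → LinearTerm t → LinearTerm (rename ρ t)
      linear-rename {ρ} {t} inj lin = subst Unique (sym (vars-rename ρ t)) (map⁺ inj lin)

      disjoint : Disjoint (vars (rename ρ₁ l)) (vars g′)
      disjoint {v} (v∈l , v∈g)
        with ∈-map⁻ ρ₁ (subst (v ∈_) (vars-rename ρ₁ l) v∈l)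
           | ∈-map⁻ ρ₂ (subst (v ∈_) (vars-rename ρ₂ g) v∈g)
      ... | x , _ , refl | y , _ , e = even≢odd x y e

      unifiable : l₀′ · θ ≡ g′ · θ
      unifiable = trans (·-· l₀ θ-even) (trans eq (sym (·-· g θ-odd)))

      solution = mgu l₀′ g′
        (linear-rename {t = l₀} double-injective (linear-⊴ p (leftLinear lr)))
        (linear-rename {t = g} (double-injective ∘ ℕ.suc-injective) (leftLinear gd))
        (λ (a , b) → disjoint (vars-⊴ p′ a , b)) θ unifiable

      μ   = proj₁ solution
      uni = proj₁ (proj₂ solution)
      mg  = proj₂ (proj₂ solution)

      μθ : ∀ x → μ x · θ ≡ θ x
      μθ x = sym (mg θ unifiable x)

-- Parallel steps

module _ {o ℓ : Level} {F : Signature o} (S : TRS F ℓ) where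

  open Signature F using (arity)

  -- The index counts the contracted redexes.
  mutual
    data Par : ℕ → Rel (Term F) (o ⊔ ℓ) where
      var  : ∀ x → Par 0 (var x) (var x)
      fun  : ∀ {n} f {ts us} → Parᵥ n ts us → Par n (fun f ts) (fun f us)
      root : ∀ {l r s t} → Rule S l r → ∀ σ → s ≡ l · σ → t ≡ r · σ → Par 1 s t

    data Parᵥ : ∀ {k} → ℕ → Rel (Vec (Term F) k) (o ⊔ ℓ) where
      []  : Parᵥ 0 [] []
      _∷_ : ∀ {k m n t u} {ts us : Vec (Term F) k} →
            Par m t u → Parᵥ n ts us → Parᵥ (m + n) (t ∷ ts) (u ∷ us)

  mutual
    par-refl : ∀ t → Par 0 t t
    par-refl (var x)    = var x
    par-refl (fun f ts) = fun f (parᵥ-refl ts)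

    parᵥ-refl : ∀ {k} (ts : Vec (Term F) k) → Parᵥ 0 ts ts
    parᵥ-refl []       = []
    parᵥ-refl (t ∷ ts) = par-refl t ∷ parᵥ-refl ts

  mutual
    -- The label is compared with 0 by a separate equation because the label of an argument list is
    -- a sum, which does not unify with 0.
    par-zero : ∀ {n t u} → Par n t u → n ≡ 0 → t ≡ u
    par-zero (var x)    _    = refl
    par-zero (fun f ps) n≡0  = cong (fun f) (parᵥ-zero ps n≡0)

    parᵥ-zero : ∀ {k n} {ts us : Vec (Term F) k} → Parᵥ n ts us → n ≡ 0 → ts ≡ us
    parᵥ-zero []                 _   = refl
    parᵥ-zero (_∷_ {m = m} p ps) n≡0 =
      cong₂ _∷_ (par-zero p (ℕ.m+n≡0⇒m≡0 m n≡0)) (parᵥ-zero ps (ℕ.m+n≡0⇒n≡0 m n≡0))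

  parᵥ-at : ∀ {k n u} (ts : Vec (Term F) k) i → Par n (lookup ts i) u → Parᵥ n ts (ts [ i ]≔ u)
  parᵥ-at {u = u} (t ∷ ts) zero    p =
    subst (λ n → Parᵥ n (t ∷ ts) (u ∷ ts)) (ℕ.+-identityʳ _) (p ∷ parᵥ-refl ts)
  parᵥ-at (t ∷ ts) (suc i) p = par-refl t ∷ parᵥ-at ts i p

  par-step : ∀ {s t} → Step S s t → Par 1 s t
  par-step (step {l = l} {r} p σ lr eq) = go p eq
    where
    go : ∀ {s} (p : Pos s) → s ∣ p ≡ l · σ → Par 1 s (s [ r · σ ]at p)
    go here                 eq = root lr σ eq refl
    go (there {f} {ts} i p) eq = fun f (parᵥ-at ts i (go p eq))

  step-at : ∀ f (ts : Vec (Term F) (arity f)) i {u} →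
            Step S (lookup ts i) u → Step S (fun f ts) (fun f (ts [ i ]≔ u))
  step-at f ts i (step p σ lr eq) = step (there i p) σ lr eq

  step-[]≔ : ∀ f (ts : Vec (Term F) (arity f)) i {t u} →
             Step S t u → Step S (fun f (ts [ i ]≔ t)) (fun f (ts [ i ]≔ u))
  step-[]≔ f ts i {t} {u} st =
    subst (λ us → Step S (fun f (ts [ i ]≔ t)) (fun f us)) ([]≔-idempotent ts i)
      (step-at f (ts [ i ]≔ t) i (subst (λ s → Step S s u) (sym (lookup∘update i ts t)) st))

  step-· : ∀ {s t} θ → Step S s t → Step S (s · θ) (t · θ)
  step-· θ (step {l = l} {r} p σ lr eq) = go p eq
    where
    go : ∀ {s} (p : Pos s) → s ∣ p ≡ l · σ → Step S (s · θ) (s [ r · σ ]at p · θ)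
    go here eq =
      subst (Step S _) (sym (·-· r λ _ → refl))
        (step here (λ x → σ x · θ) lr (trans (cong (_· θ) eq) (·-· l λ _ → refl)))
    go (there {f} {ts} i p) eq =
      subst (Step S _) (cong (fun f) (sym ([]≔-·ᵥ ts θ i _)))
        (step-at f (ts ·ᵥ θ) i
          (subst (λ s → Step S s (lookup ts i [ r · σ ]at p · θ)) (sym (lookup-·ᵥ ts θ i)) (go p eq)))

  private
    -- Steps exist on terms only, so a recursion over arguments needs a surrounding context. `c` is
    -- a function application with its first arguments fixed; each treated argument is absorbed into
    -- it.
    Compatible : ∀ {k} → (Vec (Term F) k → Term F) → Set (o ⊔ ℓ)
    Compatible c = ∀ ts i {t u} → Step S t u → Step S (c (ts [ i ]≔ t)) (c (ts [ i ]≔ u))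

    compatible-head : ∀ {k} {c : Vec (Term F) (suc k) → Term F} → Compatible c →
                      ∀ ts {t u} → Step S t u → Step S (c (t ∷ ts)) (c (u ∷ ts))
    compatible-head comp ts {t} = comp (t ∷ ts) zero

    compatible-tail : ∀ {k} {c : Vec (Term F) (suc k) → Term F} → Compatible c →
                      ∀ t → Compatible (λ ts → c (t ∷ ts))
    compatible-tail comp t ts i = comp (t ∷ ts) (suc i)

  mutual
    par⇒star : ∀ {n t u} → Par n t u → Star (Step S) t u
    par⇒star (var x)              = ε
    par⇒star (fun f ps)           = parᵥ⇒star (step-[]≔ f) ps
    par⇒star (root lr σ refl refl) = step here σ lr refl ◅ ε

    parᵥ⇒star : ∀ {k n} {c : Vec (Term F) k → Term F} {ts us} → Compatible c →
                Parᵥ n ts us → Star (Step S) (c ts) (c us)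
    parᵥ⇒star comp [] = ε
    parᵥ⇒star {c = c} comp (_∷_ {u = u} {ts = ts} p ps) =
      Star.gmap (λ t → c (t ∷ ts)) (compatible-head {c = c} comp ts) (par⇒star p) ◅◅
      parᵥ⇒star {c = λ us → c (u ∷ us)} (compatible-tail {c = c} comp u) ps

  mutual
    par⇒refl : ∀ {n t u} → Par n t u → n ≤ 1 → ReflClosure (Step S) t u
    par⇒refl (var x)               _   = refl
    par⇒refl (fun f ps)            n≤1 = parᵥ⇒refl (step-[]≔ f) ps n≤1
    par⇒refl (root lr σ refl refl) _   = [ step here σ lr refl ]

    parᵥ⇒refl : ∀ {k n} {c : Vec (Term F) k → Term F} {ts us} → Compatible c →
                Parᵥ n ts us → n ≤ 1 → ReflClosure (Step S) (c ts) (c us)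
    parᵥ⇒refl comp [] _ = refl
    parᵥ⇒refl {c = c} comp (_∷_ {m = zero} {u = u} p ps) n≤1 with par-zero p refl
    ... | refl = parᵥ⇒refl {c = λ us → c (u ∷ us)} (compatible-tail {c = c} comp u) ps n≤1
    -- The head uses up the one redex allowed, so the tail is unchanged.
    parᵥ⇒refl {c = c} comp (_∷_ {m = suc m} {ts = ts} p ps) (s≤s m+n≤0)
      with m+n≡0 ← ℕ.n≤0⇒n≡0 m+n≤0
      with refl ← ℕ.m+n≡0⇒m≡0 m m+n≡0 | refl ← parᵥ-zero ps (ℕ.m+n≡0⇒n≡0 m m+n≡0) =
      Refl.map {f = λ t → c (t ∷ ts)} (compatible-head {c = c} comp ts) (par⇒refl p ℕ.≤-refl)

  mutual
    -- Variables are listed with multiplicity, so the redexes in `σ x` count once per occurrence of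
    -- `x`. This is where a nonlinear right-hand side can raise the label.
    par-subst : ∀ t {σ σ′ : Subst} {k} → (∀ x → Par (k x) (σ x) (σ′ x)) →
                Par (sum (map k (vars t))) (t · σ) (t · σ′)
    par-subst (var x) {σ} {σ′} ps =
      subst (λ n → Par n (σ x) (σ′ x)) (sym (ℕ.+-identityʳ _)) (ps x)
    par-subst (fun f ts)      ps = fun f (parᵥ-subst ts ps)

    parᵥ-subst : ∀ {j} (ts : Vec (Term F) j) {σ σ′ : Subst} {k} → (∀ x → Par (k x) (σ x) (σ′ x)) →
                 Parᵥ (sum (map k (varsᵥ ts))) (ts ·ᵥ σ) (ts ·ᵥ σ′)
    parᵥ-subst []       ps = []
    parᵥ-subst (t ∷ ts) {k = k} ps =
      subst (λ n → Parᵥ n _ _) (sym (sum-map-++ k (vars t) (varsᵥ ts)))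
        (par-subst t ps ∷ parᵥ-subst ts ps)

  -- A parallel step from an instance of a linear term l either takes place in the
  -- substitution or contracts a redex at a non-variable position of l.
  data Split (m : ℕ) (l : Term F) (σ : Subst) (u : Term F) : Set (o ⊔ ℓ) where
    below   : ∀ σ′ k → u ≡ l · σ′ → (∀ x → Par (k x) (σ x) (σ′ x)) →
              sum (map k (vars l)) ≡ m → Split m l σ u
    redex : ∀ {l₀ g d m′} (p : l₀ ⊴ l) → ¬ IsVar l₀ → Rule S g d → ∀ τ → l₀ · σ ≡ g · τ →
              Par m′ (replace (⊴-· σ p) (d · τ)) u → m′ < m → Split m l σ u

  data Splitᵥ {j} (m : ℕ) (ls : Vec (Term F) j) (σ : Subst) (us : Vec (Term F) j) : Set (o ⊔ ℓ) where
    below   : ∀ σ′ k → us ≡ ls ·ᵥ σ′ → (∀ x → Par (k x) (σ x) (σ′ x)) →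
              sum (map k (varsᵥ ls)) ≡ m → Splitᵥ m ls σ us
    redex : ∀ {l₀ g d m′} (p : l₀ ⊴ᵥ ls) → ¬ IsVar l₀ → Rule S g d → ∀ τ → l₀ · σ ≡ g · τ →
              Parᵥ m′ (replaceᵥ (⊴ᵥ-·ᵥ σ p) (d · τ)) us → m′ < m → Splitᵥ m ls σ us

  mutual
    -- Arguments of a linear term share no variables, so substitutions found for them can be merged.
    -- If some redex overlaps `l`, the leftmost such redex is contracted ahead of the others.
    split : ∀ {m} l {σ u} → LinearTerm l → Par m (l · σ) u → Split m l σ u
    split {m} (var x) {σ} {u} _ p =
      below σ′ k (sym σ′-x) ps (trans (ℕ.+-identityʳ _) k-x)
      where
      σ′ = merge (x ∷ []) (const u) σ
      -- Away from `x` the substitution is unchanged, which is an identity step with label 0.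
      k  = merge (x ∷ []) (const m) (const 0)

      σ′-x : σ′ x ≡ u
      σ′-x = merge-∈ (x ∷ []) (const u) σ (here refl)

      k-x : k x ≡ m
      k-x = merge-∈ (x ∷ []) (const m) (const 0) (here refl)

      ps : ∀ y → Par (k y) (σ y) (σ′ y)
      ps y with y ≟ x
      ... | yes refl = subst₂ (λ n → Par n (σ x)) (sym k-x) (sym σ′-x) p
      ... | no y≢x   =
        subst₂ (λ n → Par n (σ y)) (sym (merge-∉ (x ∷ []) (const m) (const 0) y∉))
          (sym (merge-∉ (x ∷ []) (const u) σ y∉)) (par-refl (σ y))
        where
        y∉ : y ∉ x ∷ []
        y∉ (here y≡x) = y≢x y≡x

    split (fun f ls) lin (fun .f ps) with splitᵥ ls lin ps
    ... | below σ′ k eq qs sm          = below σ′ k (cong (fun f) eq) qs sm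
    ... | redex p ¬v gd τ eq qs m′<m = redex (inside p) ¬v gd τ eq (fun f qs) m′<m
    split (fun f ls) lin (root {r = r} gd τ eq refl) =
      redex here (λ ()) gd τ eq (par-refl (r · τ)) (s≤s z≤n)

    splitᵥ : ∀ {j m} (ls : Vec (Term F) j) {σ us} → Unique (varsᵥ ls) →
             Parᵥ m (ls ·ᵥ σ) us → Splitᵥ m ls σ us
    splitᵥ [] {σ} _ [] = below σ (const 0) refl (par-refl ∘ σ) refl
    splitᵥ (l ∷ ls) {σ} lin (_∷_ {m = m} {n} p ps)
      with lin-l , lin-ls , dis ← Unique-++⁻ (vars l) lin
      with split l lin-l p | splitᵥ ls lin-ls ps
    -- The tail keeps its steps `ps`; one strictly smaller summand lowers the sum.
    ... | redex q ¬v gd τ eq p′ m′<m | _ =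
      redex (head q) ¬v gd τ eq (p′ ∷ ps) (ℕ.+-monoˡ-< n m′<m)
    ... | below _ _ _ _ _ | redex q ¬v gd τ eq ps′ n′<n =
      redex (tail q) ¬v gd τ eq (p ∷ ps′) (ℕ.+-monoʳ-< m n′<n)
    ... | below σ₁ k₁ refl ps₁ sm₁ | below σ₂ k₂ refl ps₂ sm₂ =
      below (merge (vars l) σ₁ σ₂) k
        (cong₂ _∷_ (sym (·-cong l (merge-∈ (vars l) σ₁ σ₂)))
                   (sym (·ᵥ-cong ls λ x∈ls → merge-∉ (vars l) σ₁ σ₂ λ x∈l → dis (x∈l , x∈ls))))
        ps′
        (trans (sum-map-++ k (vars l) (varsᵥ ls)) (cong₂ _+_
          (trans (sum-map-cong (vars l) (merge-∈ (vars l) k₁ k₂)) sm₁)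
          (trans (sum-map-cong (varsᵥ ls) λ x∈ls → merge-∉ (vars l) k₁ k₂ λ x∈l → dis (x∈l , x∈ls)) sm₂)))
      where
      k = merge (vars l) k₁ k₂

      ps′ : ∀ x → Par (k x) (σ x) (merge (vars l) σ₁ σ₂ x)
      ps′ x with _∈?_ _≟_ x (vars l)
      ... | yes _ = ps₁ x
      ... | no _  = ps₂ x

-- Peaks of parallel steps

module _ {o ℓ e : Level} {F : Signature o} (R : TRS F ℓ) (leftLinear : LeftLinear R)
         (E : Rel (Term F) e) (E-sym : Symmetric E)
         (E-criticalPair : ∀ {s t} θ → CriticalOverlap R s t → E (s · θ) (t · θ))
         (E-[]≔ : ∀ f ts i {t u} → E t u → E (fun f (ts [ i ]≔ t)) (fun f (ts [ i ]≔ u)))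
         where

  module _ {ℓ₁ ℓ₂} (S : TRS F ℓ₁) (T : TRS F ℓ₂) where

    -- Right-hand sides of one system copy the redexes of the other, so each bound in `joined`
    -- depends on the linearity of the opposite system. The bounds are implications because `R`
    -- itself is only left-linear.
    data Peak (n m : ℕ) (t u : Term F) : Set (o ⊔ ℓ₁ ⊔ ℓ₂ ⊔ e) where
      joined     : ∀ {n′ m′ v} → Par T m′ t v → Par S n′ u v →
                   (Linear T → n′ ≤ n) → (Linear S → m′ ≤ m) → Peak n m t u
      overlapped : ∀ {n′ m′ t′ u′} → Par S n′ t′ t → E t′ u′ → Par T m′ u′ u →
                   n′ < n → m′ < m → Peak n m t u

    -- Only the argument `i` is changed by the contracted overlap. The redexes in all other
    -- arguments are left to the two shorter parallel steps.
    data Peakᵥ {k} (n m : ℕ) (ts us : Vec (Term F) k) : Set (o ⊔ ℓ₁ ⊔ ℓ₂ ⊔ e) where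
      joined     : ∀ {n′ m′ vs} → Parᵥ T m′ ts vs → Parᵥ S n′ us vs →
                   (Linear T → n′ ≤ n) → (Linear S → m′ ≤ m) → Peakᵥ n m ts us
      overlapped : ∀ {n′ m′ t′ u′} ss i → Parᵥ S n′ (ss [ i ]≔ t′) ts → E t′ u′ →
                   Parᵥ T m′ (ss [ i ]≔ u′) us → n′ < n → m′ < m → Peakᵥ n m ts us

  peak-swap : ∀ {ℓ₁ ℓ₂} {S : TRS F ℓ₁} {T : TRS F ℓ₂} {n m t u} → Peak T S m n u t → Peak S T n m t u
  peak-swap (joined p q a b)       = joined q p b a
  peak-swap (overlapped p x q a b) = overlapped q (E-sym x) p b a

  -- Without overlap the root redex survives and the `T`-redexes move into `r`, where a linear `r`
  -- does not multiply them. With an overlap the root step is used up completely, so label 0 remains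
  -- on its side.
  peak-root : ∀ {ℓ₁ ℓ₂} (S : TRS F ℓ₁) (T : TRS F ℓ₂) → Rule S ⇒ Rule R → Rule T ⇒ Rule R →
              ∀ {m l r s t u} σ → Rule S l r → s ≡ l · σ → t ≡ r · σ → Par T m s u → Peak S T 1 m t u
  peak-root S T S⊆R T⊆R {l = l} {r} σ lr refl refl p with split T l (leftLinear (S⊆R lr)) p
  ... | below σ′ k refl ps refl =
    joined (par-subst T r ps) (root lr σ′ refl refl) (λ _ → ℕ.≤-refl)
      (λ lin → sum-map-⊆ k (proj₂ (lin lr)) (rhs⊆lhs S lr))
  ... | redex q ¬v gd τ eq p′ m′<m
    with overlap-criticalPair R leftLinear (S⊆R lr) (T⊆R gd) q ¬v eq
  ... | s , t , θ , cp , eq₁ , eq₂ =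
    overlapped (par-refl S (r · σ)) (subst₂ E eq₁ eq₂ (E-criticalPair θ cp)) p′ (s≤s z≤n) m′<m

  module _ {ℓ₁ ℓ₂} (S : TRS F ℓ₁) (T : TRS F ℓ₂) (S⊆R : Rule S ⇒ Rule R) (T⊆R : Rule T ⇒ Rule R) where
    mutual
      peak : ∀ {n m s t u} → Par S n s t → Par T m s u → Peak S T n m t u
      peak (root lr σ eq₁ eq₂) q   = peak-root S T S⊆R T⊆R σ lr eq₁ eq₂ q
      peak p (root lr σ eq₁ eq₂)   = peak-swap (peak-root T S T⊆R S⊆R σ lr eq₁ eq₂ p)
      peak (var x)    (var .x)     = joined (var x) (var x) (λ _ → z≤n) (λ _ → z≤n)
      peak (fun f ps) (fun .f qs) with peakᵥ ps qs
      ... | joined ps′ qs′ a b          = joined (fun f ps′) (fun f qs′) a b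
      ... | overlapped ss i ps′ x qs′ a b = overlapped (fun f ps′) (E-[]≔ f ss i x) (fun f qs′) a b

      peakᵥ : ∀ {k n m} {ss ts us : Vec (Term F) k} → Parᵥ S n ss ts → Parᵥ T m ss us →
              Peakᵥ S T n m ts us
      peakᵥ [] [] = joined [] [] (λ _ → z≤n) (λ _ → z≤n)
      peakᵥ (_∷_ {m = n₁} {n₂} {s} {ts = ss} p ps) (_∷_ {m = m₁} {m₂} q qs) with peak p q | peakᵥ ps qs
      ... | overlapped p′ x q′ a b | _ =
        overlapped (s ∷ ss) zero (p′ ∷ ps) x (q′ ∷ qs) (ℕ.+-monoˡ-< n₂ a) (ℕ.+-monoˡ-< m₂ b)
      ... | joined _ _ _ _ | overlapped ss′ i ps′ x qs′ a b =
        overlapped (s ∷ ss′) (suc i) (p ∷ ps′) x (q ∷ qs′) (ℕ.+-monoʳ-< n₁ a) (ℕ.+-monoʳ-< m₁ b)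
      ... | joined p′ q′ a b | joined ps′ qs′ c d =
        joined (p′ ∷ ps′) (q′ ∷ qs′)
          (λ lin → ℕ.+-mono-≤ (a lin) (c lin)) (λ lin → ℕ.+-mono-≤ (b lin) (d lin))

-- Huet's criterion

module _ {o ℓ : Level} {F : Signature o} (C : TRS F ℓ) (linear : Linear C)
         (stronglyClosed : StronglyClosed C) where

  private
    StronglyJoinable : Rel (Term F) (o ⊔ ℓ)
    StronglyJoinable s t =
      (∃ λ u → Star (Step C) s u × ReflClosure (Step C) t u) ×
      (∃ λ u → ReflClosure (Step C) s u × Star (Step C) t u)

    map-joinable : (c : Term F → Term F) → (∀ {s t} → Step C s t → Step C (c s) (c t)) →
                   ∀ {s t} → StronglyJoinable s t → StronglyJoinable (c s) (c t)
    map-joinable c f ((u , p , q) , (v , p′ , q′)) =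
      (c u , Star.gmap c f p , Refl.map {f = c} f q) , (c v , Refl.map {f = c} f p′ , Star.gmap c f q′)

  -- Single steps have label 1. In a joined peak linearity keeps the second closing step at label at
  -- most 1; in an overlapped one both labels drop to 0 and strong joinability alone is left.
  linear-stronglyClosed⇒confluent : Confluent (Step C)
  linear-stronglyClosed⇒confluent = stronglyConfluent⇒confluent sc
    where
    sc : StronglyConfluent
    sc st₁ st₂
      with peak C (λ lr → proj₁ (linear lr)) StronglyJoinable
             -- Exchanging the two terms exchanges the two halves of strong joinability.
             (λ ((u , p , q) , (v , p′ , q′)) → (v , q′ , p′) , (u , q , p))
             (λ θ cp → map-joinable (_· θ) (step-· C θ) (stronglyClosed (fwd cp)))
             (λ f ts i → map-joinable (λ t → fun f (ts [ i ]≔ t)) (step-[]≔ C f ts i))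
             C C id id (par-step C st₁) (par-step C st₂)
    ... | joined p q n≤1 _ = _ , par⇒star C p , par⇒refl C q (n≤1 linear)
    ... | overlapped p x q (s≤s n≤0) (s≤s m≤0)
      with refl ← par-zero C p (ℕ.n≤0⇒n≡0 n≤0) | refl ← par-zero C q (ℕ.n≤0⇒n≡0 m≤0) = proj₁ x

-- Confluence by a confluent critical-pair-closing system

module _ {o ℓ₁ ℓ₂ : Level} {F : Signature o} (R : TRS F ℓ₁) (leftLinear : LeftLinear R)
         (C : TRS F ℓ₂) (closing : CriticalPairClosing C R)
         (linear : Linear C) (confluent : Confluent (Step C)) where

  open CriticalPairClosing closing

  private
    infix 4 _↠_ _≈_ _⇛_
    infixr 5 _◇_

    _↠_ _≈_ : Rel (Term F) (o ⊔ ℓ₂)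
    _↠_ = Star (Step C)
    _≈_ = EqClosure (Step C)

    ≈-sym : Symmetric _≈_
    ≈-sym = Eq.symmetric (Step C)

    _◇_ : ∀ {s t u} → s ≈ t → t ≈ u → s ≈ u
    _◇_ = _◅◅_

    subsystem-step : Step C ⇒ Step R
    subsystem-step (step p σ lr eq) = step p σ (subsystem lr) eq

    peakR : ∀ {ℓ} (T : TRS F ℓ) → Rule T ⇒ Rule R → ∀ {n m s t u} →
            Par R n s t → Par T m s u → Peak R leftLinear _≈_ ≈-sym _ _ R T n m t u
    peakR T = peak R leftLinear _≈_ ≈-sym
      (λ θ cp → Eq.gmap (_· θ) (step-· C θ) (closes (fwd cp)))
      (λ f ts i → Eq.gmap (λ t → fun f (ts [ i ]≔ t)) (step-[]≔ C f ts i))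
      R T id

    -- `smaller` is the outcome when a `C`-step overlaps the parallel step: up to convertibility a
    -- parallel step with a smaller label takes its place, which feeds the inductions below.
    data Project (n : ℕ) (s′ t : Term F) : Set (o ⊔ ℓ₁ ⊔ ℓ₂) where
      residual : ∀ {n′ t′} → Par R n′ s′ t′ → t ↠ t′ → n′ ≤ n → Project n s′ t
      smaller  : ∀ {n′ s″ t′} → s′ ≈ s″ → Par R n′ s″ t′ → t ≈ t′ → n′ < n → Project n s′ t

    -- Linearity of C keeps the number of contracted redexes from growing.
    project : ∀ {n s s′ t} → Par R n s t → s ↠ s′ → Project n s′ t
    project p ε = residual p ε ℕ.≤-refl
    project p (st ◅ sts) with peakR C subsystem p (par-step C st)
    -- A `C`-step has label 1, so after the overlap its remainder `q` is an identity.
    ... | overlapped p′ x q a (s≤s m≤0) with refl ← par-zero C q (ℕ.n≤0⇒n≡0 m≤0) =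
      smaller (≈-sym (star⇒eq sts) ◇ ≈-sym x) p′ ε a
    ... | joined q p′ a _ with project p′ sts
    ... | residual p″ r b  = residual p″ (par⇒star C q ◅◅ r) (ℕ.≤-trans b (a linear))
    ... | smaller x p″ y b = smaller x p″ (star⇒eq (par⇒star C q) ◇ y) (ℕ.<-≤-trans b (a linear))

    data _⇛_ (s t : Term F) : Set (o ⊔ ℓ₁ ⊔ ℓ₂) where
      modulo : ∀ {n s′ t′} → s ≈ s′ → Par R n s′ t′ → t′ ≈ t → s ⇛ t

    ≈-⇛ : ∀ {s t u} → s ≈ t → t ⇛ u → s ⇛ u
    ≈-⇛ x (modulo y p z) = modulo (x ◇ y) p z

    -- Both steps are projected to a common `C`-reduct `w` of their sources. An overlap, met on the
    -- way or at `w`, lowers `n + m` and leaves convertible sources, to which the induction applies;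
    -- `k` bounds `n + m` for termination.
    ⇛-diamond : ∀ k {n m s s′ t u} → n + m < k → s ≈ s′ → Par R n s t → Par R m s′ u →
                ∃ λ v → t ⇛ v × u ⇛ v
    ⇛-diamond (suc k) {n} {m} (s≤s n+m≤k) s≈s′ p q
      with w , s↠w , s′↠w ← confluent⇒churchRosser confluent s≈s′
      with project p s↠w
    ... | smaller x p′ y a =
      let v , l , r = ⇛-diamond k (ℕ.<-≤-trans (ℕ.+-monoˡ-< m a) n+m≤k)
                        (≈-sym x ◇ ≈-sym (star⇒eq s′↠w)) p′ q
      in v , ≈-⇛ y l , r
    ... | residual p′ t↠ a with project q s′↠w
    ... | smaller x q′ y b =
      let v , l , r = ⇛-diamond k (ℕ.<-≤-trans (ℕ.+-monoʳ-< n b) n+m≤k)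
                        (star⇒eq s↠w ◇ x) p q′
      in v , l , ≈-⇛ y r
    ... | residual q′ u↠ b with peakR R id p′ q′
    ... | joined c d _ _ = _ , modulo (star⇒eq t↠) c ε , modulo (star⇒eq u↠) d ε
    ... | overlapped c x d e f =
      -- Projection did not raise the labels, so dropping below the projected ones means dropping
      -- below `n` and `m`.
      let k′ = ℕ.+-mono-<-≤ (ℕ.<-≤-trans e a) (ℕ.<⇒≤ (ℕ.<-≤-trans f b))
          v , l , r = ⇛-diamond k (ℕ.<-≤-trans k′ n+m≤k) x c d
      in v , ≈-⇛ (star⇒eq t↠) l , ≈-⇛ (star⇒eq u↠) r

    ⇛-confluent : Confluent _⇛_
    ⇛-confluent = stronglyConfluent⇒confluent λ where
      (modulo x p y) (modulo x′ q y′) →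
        let v , l , r = ⇛-diamond _ ℕ.≤-refl (≈-sym x ◇ x′) p q
        in v , ≈-⇛ (≈-sym y) l ◅ ε , [ ≈-⇛ (≈-sym y′) r ]

    C⇒R : ∀ {s t} → s ↠ t → Star (Step R) s t
    C⇒R = Star.map subsystem-step

    -- From `s` a `C`-reduction, which is also an `R`-reduction, leads to a common reduct `w` with
    -- `s′`. Either the parallel step projects to `w`, or the argument restarts at `w` with a
    -- smaller label.
    par-lift : ∀ k {n s s′ t} → n < k → s ≈ s′ → Par R n s′ t → ∃ λ u → Star (Step R) s u × u ≈ t
    par-lift (suc k) (s≤s n≤k) s≈s′ p
      with w , s↠w , s′↠w ← confluent⇒churchRosser confluent s≈s′
      with project p s′↠w
    ... | residual p′ t↠ _ = _ , C⇒R s↠w ◅◅ par⇒star R p′ , ≈-sym (star⇒eq t↠)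
    ... | smaller x p′ y a =
      let u , r , z = par-lift k (ℕ.<-≤-trans a n≤k) x p′
      in u , C⇒R s↠w ◅◅ r , z ◇ ≈-sym y

    ⇛-lift : ∀ {s s′ t} → s ≈ s′ → Star _⇛_ s′ t → ∃ λ u → Star (Step R) s u × u ≈ t
    ⇛-lift s≈s′ ε                     = _ , ε , s≈s′
    ⇛-lift s≈s′ (modulo x p y ◅ steps) =
      let u , r , z   = par-lift _ ℕ.≤-refl (s≈s′ ◇ x) p
          v , r′ , z′ = ⇛-lift (z ◇ y) steps
      in v , r ◅◅ r′ , z′

    embed : Step R ⇒ _⇛_
    embed st = modulo ε (par-step R st) ε

  criticalPairClosing⇒confluent : Confluent (Step R)
  criticalPairClosing⇒confluent p q =
    let v , a , b   = ⇛-confluent (Star.map embed p) (Star.map embed q)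
        t , c , t≈v = ⇛-lift ε a
        u , d , u≈v = ⇛-lift ε b
        -- The lifted reducts are convertible in `C` through `v`, and a common `C`-reduct closes the
        -- peak in `R`.
        w , e , f   = confluent⇒churchRosser confluent (t≈v ◇ ≈-sym u≈v)
    in w , c ◅◅ C⇒R e , d ◅◅ C⇒R f

corollary3 : ∀ {o ℓ₁ ℓ₂ : Level} {F : Signature o} (R : TRS F ℓ₁) →
    LeftLinear R →
    (∃ λ (C : TRS F ℓ₂) → CriticalPairClosing C R × Linear C × StronglyClosed C) →
    Confluent (Step R)
corollary3 R leftLinear (C , closing , linear , stronglyClosed) =
  criticalPairClosing⇒confluent R leftLinear C closing linear
    (linear-stronglyClosed⇒confluent C linear stronglyClosed)
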